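{- Let $x$ be a $\lambda$-variable, let $n$ be a natural number and let $M_1,\dots,M_n$ be terms of the symmetric $\lambda\mu$-calculus. If $M_1,\dots,M_n$ are in $SN$, then $(x\; M_1 \dots M_n) \in SN$.
   Context: Terms of the (untyped) symmetric $\lambda\mu$-calculus are given by the grammar $\mathcal T ::= x \mid \lambda x\,\mathcal T \mid (\mathcal T\;\mathcal T) \mid \mu\alpha\,\mathcal T \mid (\alpha\;\mathcal T)$, where $x,y,\dots$ range over $\lambda$-variables and $\alpha,\beta,\dots$ over $\mu$-variables ($\lambda x$ binds $x$, $\mu\alpha$ binds $\alpha$; terms are taken up to renaming of bound variables, and substitutions are capture-avoiding). Application associates to the left: $(M\;N_1\dots N_n)$ means $((M\;N_1)\dots N_n)$. One-step reduction $\triangleright$ is the closure under all term contexts of the three rules ($\beta$) $(\lambda x M\;N)\triangleright M[x:=N]$; ($\mu$) $(\mu\alpha M\;N)\triangleright \mu\alpha\, M[\alpha=_r N]$; ($\mu'$) $(M\;\mu\alpha N)\triangleright \mu\alpha\, N[\alpha=_l M]$. Here $M[\alpha=_r N]$ is obtained from $M$ by (recursively) replacing each sub-term of $M$ of the form $(\alpha\;U)$ ($\alpha$ free) by $(\alpha\;(U\;N))$, and $N[\alpha=_l M]$ is obtained from $N$ by (recursively) replacing each sub-term of $N$ of the form $(\alpha\;U)$ by $(\alpha\;(M\;U))$. $SN$ is the set of terms having no infinite $\triangleright$-reduction sequence. -}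

module Defs where

open import Axiom.ExcludedMiddle using (ExcludedMiddle)
open import Data.Empty using (⊥-elim)
open import Data.Fin using (Fin; zero; suc; lift; _≟_)
open import Data.Nat using (ℕ; zero; suc)
open import Data.Product using (Σ; ∃; _×_; _,_; proj₁; proj₂)
open import Data.Vec using (Vec; foldl′)
open import Function using (id; _∘_; flip)
open import Induction.InfiniteDescent using (InfiniteDescendingSequenceFrom)
open import Induction.WellFounded using (Acc; acc)
open import Level using (0ℓ)
open import Relation.Binary.PropositionalEquality using (refl)
open import Relation.Nullary using (¬_; yes; no; contradiction)

private
  variable
    l l′ m m′ : ℕ

-- Terms up to α-equivalence: well-scoped de Bruijn syntax with two separate
-- index spaces. The free λ-variables of a Term l m are drawn from Fin l and
-- its free μ-variables from Fin m. The named term [ α ] M stands for (α M).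
infixl 7 _·_
infix  8 [_]_

data Term (l m : ℕ) : Set where
  var  : Fin l → Term l m
  ƛ    : Term (suc l) m → Term l m
  _·_  : Term l m → Term l m → Term l m
  μ    : Term l (suc m) → Term l m
  [_]_ : Fin m → Term l m → Term l m

rename : (Fin l → Fin l′) → (Fin m → Fin m′) → Term l m → Term l′ m′
rename ρ θ (var x)   = var (ρ x)
rename ρ θ (ƛ M)     = ƛ (rename (lift 1 ρ) θ M)
rename ρ θ (M · N)   = rename ρ θ M · rename ρ θ N
rename ρ θ (μ M)     = μ (rename ρ (lift 1 θ) M)
rename ρ θ ([ α ] M) = [ θ α ] rename ρ θ M

wkλ : Term l m → Term (suc l) m
wkλ = rename suc id

wkμ : Term l m → Term l (suc m)
wkμ = rename id suc

liftₛ : (Fin l → Term l′ m) → Fin (suc l) → Term (suc l′) m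
liftₛ σ zero    = var zero
liftₛ σ (suc x) = wkλ (σ x)

substλ : (Fin l → Term l′ m) → Term l m → Term l′ m
substλ σ (var x)   = σ x
substλ σ (ƛ M)     = ƛ (substλ (liftₛ σ) M)
substλ σ (M · N)   = substλ σ M · substλ σ N
substλ σ (μ M)     = μ (substλ (wkμ ∘ σ) M)
substλ σ ([ α ] M) = [ α ] substλ σ M

single : Term l m → Fin (suc l) → Term l m
single N zero    = N
single N (suc x) = var x

-- M [x≔ N ] replaces the λ-variable with index zero by N.
infix 9 _[x≔_]
_[x≔_] : Term (suc l) m → Term l m → Term l m
M [x≔ N ] = substλ (single N) M

-- M [ α =ᵣ N ] replaces every subterm (α U) of M by (α (U N)), and
-- M [ α =ₗ N ] replaces every subterm (α U) of M by (α (N U)), recursively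
-- inside U but not inside the inserted copies of N. The variable α itself
-- survives, so the scope does not change.
infix 9 _[_=ᵣ_] _[_=ₗ_]

_[_=ᵣ_] : Term l m → Fin m → Term l m → Term l m
(var x)   [ α =ᵣ N ] = var x
(ƛ M)     [ α =ᵣ N ] = ƛ (M [ α =ᵣ wkλ N ])
(M · P)   [ α =ᵣ N ] = (M [ α =ᵣ N ]) · (P [ α =ᵣ N ])
(μ M)     [ α =ᵣ N ] = μ (M [ suc α =ᵣ wkμ N ])
([ β ] U) [ α =ᵣ N ] with β ≟ α
... | yes _ = [ β ] ((U [ α =ᵣ N ]) · N)
... | no  _ = [ β ] (U [ α =ᵣ N ])

_[_=ₗ_] : Term l m → Fin m → Term l m → Term l m
(var x)   [ α =ₗ N ] = var x
(ƛ M)     [ α =ₗ N ] = ƛ (M [ α =ₗ wkλ N ])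
(M · P)   [ α =ₗ N ] = (M [ α =ₗ N ]) · (P [ α =ₗ N ])
(μ M)     [ α =ₗ N ] = μ (M [ suc α =ₗ wkμ N ])
([ β ] U) [ α =ₗ N ] with β ≟ α
... | yes _ = [ β ] (N · (U [ α =ₗ N ]))
... | no  _ = [ β ] (U [ α =ₗ N ])

infix 4 _▷_

data _▷_ {l m : ℕ} : Term l m → Term l m → Set where
  β-red  : ∀ {M N} → ƛ M · N ▷ M [x≔ N ]
  μ-red  : ∀ {M N} → μ M · N ▷ μ (M [ zero =ᵣ wkμ N ])
  μ′-red : ∀ {M N} → M · μ N ▷ μ (N [ zero =ₗ wkμ M ])
  ξ-ƛ    : ∀ {M M′} → M ▷ M′ → ƛ M ▷ ƛ M′
  ξ-·ˡ   : ∀ {M M′ N} → M ▷ M′ → M · N ▷ M′ · N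
  ξ-·ʳ   : ∀ {M N N′} → N ▷ N′ → M · N ▷ M · N′
  ξ-μ    : ∀ {M M′} → M ▷ M′ → μ M ▷ μ M′
  ξ-name : ∀ {α M M′} → M ▷ M′ → [ α ] M ▷ [ α ] M′

-- Strong normalization as accessibility, the pointwise form of
-- StronglyNormalizing in Relation.Binary.Rewriting. The lemmas
-- SN⇒¬infinite and ¬infinite⇒SN show that, classically, it says exactly that
-- no infinite reduction sequence starts from the term.
SN : Term l m → Set
SN = Acc (flip _▷_)

InfiniteReductionFrom : Term l m → Set
InfiniteReductionFrom M = ∃ λ f → InfiniteDescendingSequenceFrom (flip _▷_) f M

SN⇒¬infinite : {M : Term l m} → SN M → ¬ InfiniteReductionFrom M
SN⇒¬infinite (acc rs) (f , refl , steps) =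
  SN⇒¬infinite (rs (steps 0)) (f ∘ suc , refl , steps ∘ suc)

¬infinite⇒SN : ExcludedMiddle 0ℓ →
               {M : Term l m} → ¬ InfiniteReductionFrom M → SN M
¬infinite⇒SN {l} {m} em {M} ¬inf with em {SN M}
... | yes sn = sn
... | no ¬sn = ⊥-elim (¬inf (proj₁ ∘ seq , refl , steps))
  where
  NonSN : Set
  NonSN = Σ (Term l m) (¬_ ∘ SN)

  next : (P : NonSN) → Σ NonSN λ Q → proj₁ P ▷ proj₁ Q
  next (P , ¬snP) with em {Σ (Term l m) λ Q → P ▷ Q × ¬ SN Q}
  ... | yes (Q , P▷Q , ¬snQ) = (Q , ¬snQ) , P▷Q
  ... | no ∄Q = contradiction (acc reducts) ¬snP
    where
    reducts : ∀ {Q} → P ▷ Q → SN Q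
    reducts {Q} P▷Q with em {SN Q}
    ... | yes snQ = snQ
    ... | no ¬snQ = ⊥-elim (∄Q (Q , P▷Q , ¬snQ))

  seq : ℕ → NonSN
  seq zero    = M , ¬sn
  seq (suc n) = proj₁ (next (seq n))

  steps : ∀ n → proj₁ (seq n) ▷ proj₁ (seq (suc n))
  steps n = proj₂ (next (seq n))

-- apply M (N₁ ∷ … ∷ Nₙ ∷ []) is (M N₁ … Nₙ), associated to the left.
apply : {n : ℕ} → Term l m → Vec (Term l m) n → Term l m
apply = foldl′ _·_

{-# OPTIONS --safe #-}
module Submission where

-- Applying a neutral term M to N pushes N to the arguments of the named subterms of M
-- (μ) or M to those of N (μ′); β never fires at the root. Iterating, one meets only
-- applications of instances U[σ] · V[τ], where U is a proper subterm of a reduct of M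
-- and V one of N, and where σ puts around named subterms of U frames □ · V′[τ′], and τ
-- frames U′[σ′] · □ in V. Strong normalization of all these applications follows by
-- induction on the pair (U , V), from the relation Ok: a frame □ · X is Ok for U if
-- plugging U′[σ′] into it gives a strongly normalizing term for every proper descendant
-- U′ of U and every σ′ whose frames are Ok for U′. Since Ok only speaks of strictly
-- smaller U′, the induction hypothesis makes V[τ] Ok for U and U[σ] Ok for V, so that
-- after a μ or μ′ step all frames are again Ok; an instance of a strongly normalizing
-- term in Ok frames is strongly normalizing.

open import Data.Bool using (Bool; true; false; T)
open import Data.Empty using (⊥-elim)
open import Data.Nat using (ℕ; zero; suc)
open import Data.Fin using (Fin; zero; suc; lift; _≟_)
open import Data.List using (List; []; _∷_; _++_; map)
open import Data.List.Properties using (map-++; map-∘; map-cong; map-id; ++-identityʳ)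
open import Data.List.Relation.Binary.Pointwise using (Pointwise; []; _∷_)
open import Data.Product using (∃; _×_; _,_; proj₁; proj₂)
open import Data.Unit using (tt)
open import Data.Vec using (Vec; []; _∷_)
open import Data.Vec.Relation.Unary.All using (All; []; _∷_)
open import Function using (id; _∘_)
open import Induction.WellFounded using (acc)
open import Relation.Binary.Construct.Closure.ReflexiveTransitive
  using (Star; ε; _◅_; _◅◅_; gmap)
open import Relation.Binary.PropositionalEquality
  using (_≡_; refl; sym; trans; cong; cong₂; subst; subst₂; _≗_)
open import Relation.Nullary using (¬_; yes; no; contradiction)
open import Defs

private
  variable
    l l′ l″ m m′ m″ : ℕ

-- Renamings and simultaneous substitutions

-- The composite is known only through pointwise equations, so going under a binder means extending
-- an equation by one case and needs no function extensionality. The later fusion laws have the same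
-- shape.
rename-fuse : ∀ {ρ : Fin l → Fin l′} {θ : Fin m → Fin m′}
  {ρ′ : Fin l′ → Fin l″} {θ′ : Fin m′ → Fin m″}
  {ρ″ : Fin l → Fin l″} {θ″ : Fin m → Fin m″} →
  ρ′ ∘ ρ ≗ ρ″ → θ′ ∘ θ ≗ θ″ →
  rename ρ′ θ′ ∘ rename ρ θ ≗ rename ρ″ θ″
rename-fuse p q (var x)   = cong var (p x)
rename-fuse p q (ƛ M)     = cong ƛ (rename-fuse (λ { zero → refl ; (suc x) → cong suc (p x) }) q M)
rename-fuse p q (M · N)   = cong₂ _·_ (rename-fuse p q M) (rename-fuse p q N)
rename-fuse p q (μ M)     = cong μ (rename-fuse p (λ { zero → refl ; (suc x) → cong suc (q x) }) M)
rename-fuse p q ([ α ] M) = cong₂ [_]_ (q α) (rename-fuse p q M)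

rename-comm : ∀ {l₁ m₁ l₂ m₂} {ρ : Fin l → Fin l₁} {θ : Fin m → Fin m₁}
  {ρ′ : Fin l₁ → Fin l″} {θ′ : Fin m₁ → Fin m″}
  {κ : Fin l → Fin l₂} {ι : Fin m → Fin m₂}
  {κ′ : Fin l₂ → Fin l″} {ι′ : Fin m₂ → Fin m″} →
  ρ′ ∘ ρ ≗ κ′ ∘ κ → θ′ ∘ θ ≗ ι′ ∘ ι →
  rename ρ′ θ′ ∘ rename ρ θ ≗ rename κ′ ι′ ∘ rename κ ι
rename-comm p q M =
  trans (rename-fuse p q M) (sym (rename-fuse (λ _ → refl) (λ _ → refl) M))

rename-id : ∀ {ρ : Fin l → Fin l} {θ : Fin m → Fin m} →
  ρ ≗ id → θ ≗ id → rename ρ θ ≗ id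
rename-id p q (var x)   = cong var (p x)
rename-id p q (ƛ M)     = cong ƛ (rename-id (λ { zero → refl ; (suc x) → cong suc (p x) }) q M)
rename-id p q (M · N)   = cong₂ _·_ (rename-id p q M) (rename-id p q N)
rename-id p q (μ M)     = cong μ (rename-id p (λ { zero → refl ; (suc x) → cong suc (q x) }) M)
rename-id p q ([ α ] M) = cong₂ [_]_ (q α) (rename-id p q M)

-- The side is that of the hole: (left , N) stands for the context □ · N.
data Side : Set where
  left right : Side

Frame : ℕ → ℕ → Set
Frame l m = Side × Term l m

infill : Side → Term l m → Term l m → Term l m
infill left  N X = X · N
infill right N X = N · X

plug : List (Frame l m) → Term l m → Term l m
plug []             X = X
plug ((s , N) ∷ fs) X = plug fs (infill s N X)

plug-++ : ∀ fs {gs} {X : Term l m} → plug (fs ++ gs) X ≡ plug gs (plug fs X)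
plug-++ []       = refl
plug-++ (f ∷ fs) = plug-++ fs

onTerm : (Term l m → Term l′ m′) → Frame l m → Frame l′ m′
onTerm f (s , N) = s , f N

-- nm renames the μ-variables, and cx α is the stack of frames that goes
-- between [ α ] and its argument.
record Sub (l m l′ m′ : ℕ) : Set where
  constructor ⟪_,_,_⟫
  field
    tm : Fin l → Term l′ m′
    nm : Fin m → Fin m′
    cx : Fin m → List (Frame l′ m′)
open Sub

push : ∀ {A : Set} → A → (Fin m → A) → Fin (suc m) → A
push a f zero    = a
push a f (suc α) = f α

⇑λ : Sub l m l′ m′ → Sub (suc l) m (suc l′) m′
⇑λ S = ⟪ liftₛ (tm S) , nm S , map (onTerm wkλ) ∘ cx S ⟫

-- The bound variable may receive a stack of its own because a μ- or μ′-step on an instance of `μ M`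
-- wraps the arguments of exactly that variable.
⇑μ⟨_⟩ : List (Frame l′ (suc m′)) → Sub l m l′ m′ → Sub l (suc m) l′ (suc m′)
⇑μ⟨ fs ⟩ S = ⟪ wkμ ∘ tm S , lift 1 (nm S) , push fs (map (onTerm wkμ) ∘ cx S) ⟫

⇑μ : Sub l m l′ m′ → Sub l (suc m) l′ (suc m′)
⇑μ = ⇑μ⟨ [] ⟩

sub : Sub l m l′ m′ → Term l m → Term l′ m′
sub S (var x)   = tm S x
sub S (ƛ M)     = ƛ (sub (⇑λ S) M)
sub S (M · N)   = sub S M · sub S N
sub S (μ M)     = μ (sub (⇑μ S) M)
sub S ([ α ] M) = [ nm S α ] plug (cx S α) (sub S M)

ren : (Fin l → Fin l′) → (Fin m → Fin m′) → Sub l m l′ m′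
ren ρ θ = ⟪ var ∘ ρ , θ , (λ _ → []) ⟫

-- In `cx≡` the frames of `S` come first because the head of a stack is innermost: `R` acts on what
-- `S` has inserted and adds its own frames outside.
record Comp (S : Sub l m l′ m′) (R : Sub l′ m′ l″ m″) (Q : Sub l m l″ m″) : Set where
  constructor comp
  field
    tm≡ : ∀ x → sub R (tm S x) ≡ tm Q x
    nm≡ : ∀ α → nm R (nm S α) ≡ nm Q α
    cx≡ : ∀ α → map (onTerm (sub R)) (cx S α) ++ cx R (nm S α) ≡ cx Q α
open Comp

rename-plug : ∀ {ρ : Fin l → Fin l′} {θ : Fin m → Fin m′} fs {X} →
  rename ρ θ (plug fs X) ≡ plug (map (onTerm (rename ρ θ)) fs) (rename ρ θ X)
rename-plug []                 = refl
rename-plug ((left  , N) ∷ fs) = rename-plug fs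
rename-plug ((right , N) ∷ fs) = rename-plug fs

sub-plug : ∀ {S : Sub l m l′ m′} fs {X} →
  sub S (plug fs X) ≡ plug (map (onTerm (sub S)) fs) (sub S X)
sub-plug []                 = refl
sub-plug ((left  , N) ∷ fs) = sub-plug fs
sub-plug ((right , N) ∷ fs) = sub-plug fs

map-comm : ∀ {A B C D : Set} {f : A → B} {g : B → D} {h : A → C} {k : C → D} →
  (∀ x → g (f x) ≡ k (h x)) → ∀ xs → map g (map f xs) ≡ map k (map h xs)
map-comm eq xs = trans (sym (map-∘ xs)) (trans (map-cong eq xs) (map-∘ xs))

frames-comm : ∀ {l₁ m₁ l₂ m₂} {f : Term l m → Term l₁ m₁} {g : Term l₁ m₁ → Term l″ m″}
  {h : Term l m → Term l₂ m₂} {k : Term l₂ m₂ → Term l″ m″} →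
  (∀ M → g (f M) ≡ k (h M)) →
  ∀ fs → map (onTerm g) (map (onTerm f) fs) ≡ map (onTerm k) (map (onTerm h) fs)
frames-comm eq = map-comm λ { (s , N) → cong (s ,_) (eq N) }

sub-rename : ∀ {ρ : Fin l → Fin l′} {θ : Fin m → Fin m′}
  {S : Sub l′ m′ l″ m″} {Q : Sub l m l″ m″} →
  tm S ∘ ρ ≗ tm Q → nm S ∘ θ ≗ nm Q → cx S ∘ θ ≗ cx Q →
  sub S ∘ rename ρ θ ≗ sub Q
sub-rename p q r (var x)   = p x
sub-rename p q r (ƛ M)     = cong ƛ (sub-rename
  (λ { zero → refl ; (suc x) → cong wkλ (p x) }) q (λ α → cong (map (onTerm wkλ)) (r α)) M)
sub-rename p q r (M · N)   = cong₂ _·_ (sub-rename p q r M) (sub-rename p q r N)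
sub-rename p q r (μ M)     = cong μ (sub-rename (λ x → cong wkμ (p x))
  (λ { zero → refl ; (suc α) → cong suc (q α) })
  (λ { zero → refl ; (suc α) → cong (map (onTerm wkμ)) (r α) }) M)
sub-rename p q r ([ α ] M) = cong₂ [_]_ (q α) (cong₂ plug (r α) (sub-rename p q r M))

rename-sub : ∀ {S : Sub l m l′ m′} {ρ : Fin l′ → Fin l″} {θ : Fin m′ → Fin m″}
  {Q : Sub l m l″ m″} →
  rename ρ θ ∘ tm S ≗ tm Q → θ ∘ nm S ≗ nm Q → map (onTerm (rename ρ θ)) ∘ cx S ≗ cx Q →
  rename ρ θ ∘ sub S ≗ sub Q
rename-sub p q r (var x)   = p x
rename-sub {S = S} p q r (ƛ M)     = cong ƛ (rename-sub
  (λ { zero → refl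
     ; (suc x) → trans (rename-comm (λ _ → refl) (λ _ → refl) (tm S x)) (cong wkλ (p x)) })
  q
  (λ α → trans (frames-comm (rename-comm (λ _ → refl) (λ _ → refl)) (cx S α))
               (cong (map (onTerm wkλ)) (r α))) M)
rename-sub p q r (M · N)   = cong₂ _·_ (rename-sub p q r M) (rename-sub p q r N)
rename-sub {S = S} p q r (μ M)     = cong μ (rename-sub
  (λ x → trans (rename-comm (λ _ → refl) (λ _ → refl) (tm S x)) (cong wkμ (p x)))
  (λ { zero → refl ; (suc α) → cong suc (q α) })
  (λ { zero → refl
     ; (suc α) → trans (frames-comm (rename-comm (λ _ → refl) (λ _ → refl)) (cx S α))
                       (cong (map (onTerm wkμ)) (r α)) }) M)
rename-sub {S = S} p q r ([ α ] M) = cong₂ [_]_ (q α)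
  (trans (rename-plug (cx S α)) (cong₂ plug (r α) (rename-sub p q r M)))

sub-wkλ : ∀ {S : Sub l m l′ m′} M → sub (⇑λ S) (wkλ M) ≡ wkλ (sub S M)
sub-wkλ M = trans (sub-rename (λ _ → refl) (λ _ → refl) (λ _ → refl) M)
                  (sym (rename-sub (λ _ → refl) (λ _ → refl) (λ _ → refl) M))

sub-wkμ : ∀ {S : Sub l m l′ m′} {fs} M → sub (⇑μ⟨ fs ⟩ S) (wkμ M) ≡ wkμ (sub S M)
sub-wkμ M = trans (sub-rename (λ _ → refl) (λ _ → refl) (λ _ → refl) M)
                  (sym (rename-sub (λ _ → refl) (λ _ → refl) (λ _ → refl) M))

Comp-⇑λ : ∀ {S : Sub l m l′ m′} {R : Sub l′ m′ l″ m″} {Q} →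
  Comp S R Q → Comp (⇑λ S) (⇑λ R) (⇑λ Q)
Comp-⇑λ {S = S} {R} c = comp
  (λ { zero → refl ; (suc x) → trans (sub-wkλ (tm S x)) (cong wkλ (tm≡ c x)) })
  (nm≡ c)
  (λ α → trans (cong (_++ _) (frames-comm sub-wkλ (cx S α)))
        (trans (sym (map-++ _ (map (onTerm (sub R)) (cx S α)) _)) (cong (map _) (cx≡ c α))))

Comp-⇑μ : ∀ {S : Sub l m l′ m′} {R : Sub l′ m′ l″ m″} {Q} {fs gs hs} →
  map (onTerm (sub (⇑μ⟨ gs ⟩ R))) fs ++ gs ≡ hs →
  Comp S R Q → Comp (⇑μ⟨ fs ⟩ S) (⇑μ⟨ gs ⟩ R) (⇑μ⟨ hs ⟩ Q)
Comp-⇑μ {S = S} {R} eq c = comp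
  (λ x → trans (sub-wkμ (tm S x)) (cong wkμ (tm≡ c x)))
  (λ { zero → refl ; (suc α) → cong suc (nm≡ c α) })
  (λ { zero → eq
     ; (suc α) → trans (cong (_++ _) (frames-comm sub-wkμ (cx S α)))
        (trans (sym (map-++ _ (map (onTerm (sub R)) (cx S α)) _)) (cong (map _) (cx≡ c α))) })

sub-sub : ∀ {S : Sub l m l′ m′} {R : Sub l′ m′ l″ m″} {Q} →
  Comp S R Q → sub R ∘ sub S ≗ sub Q
sub-sub c (var x)   = tm≡ c x
sub-sub c (ƛ M)     = cong ƛ (sub-sub (Comp-⇑λ c) M)
sub-sub c (M · N)   = cong₂ _·_ (sub-sub c M) (sub-sub c N)
sub-sub c (μ M)     = cong μ (sub-sub (Comp-⇑μ refl c) M)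
sub-sub {S = S} {R} c ([ α ] M) = cong₂ [_]_ (nm≡ c α)
  (trans (cong (plug (cx R (nm S α))) (sub-plug (cx S α)))
  (trans (sym (plug-++ (map (onTerm (sub R)) (cx S α))))
  (cong₂ plug (cx≡ c α) (sub-sub c M))))

sub-ren : ∀ {S : Sub l m l′ m′} {ρ : Fin l → Fin l′} {θ : Fin m → Fin m′} →
  tm S ≗ var ∘ ρ → nm S ≗ θ → cx S ≗ (λ _ → []) → sub S ≗ rename ρ θ
sub-ren p q r (var x)   = p x
sub-ren p q r (ƛ M)     = cong ƛ (sub-ren
  (λ { zero → refl ; (suc x) → cong wkλ (p x) }) q (λ α → cong (map _) (r α)) M)
sub-ren p q r (M · N)   = cong₂ _·_ (sub-ren p q r M) (sub-ren p q r N)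
sub-ren p q r (μ M)     = cong μ (sub-ren (λ x → cong wkμ (p x))
  (λ { zero → refl ; (suc α) → cong suc (q α) })
  (λ { zero → refl ; (suc α) → cong (map _) (r α) }) M)
sub-ren p q r ([ α ] M) = cong₂ [_]_ (q α) (cong₂ plug (r α) (sub-ren p q r M))

ids : Sub l m l m
ids = ren id id

sub-ids : (M : Term l m) → sub ids M ≡ M
sub-ids M = trans (sub-ren (λ _ → refl) (λ _ → refl) (λ _ → refl) M)
                  (rename-id (λ _ → refl) (λ _ → refl) M)

substλ-sub : ∀ {S : Sub l m l′ m} {σ} → tm S ≗ σ → nm S ≗ id → cx S ≗ (λ _ → []) →
  sub S ≗ substλ σ
substλ-sub p q r (var x)   = p x
substλ-sub p q r (ƛ M)     = cong ƛ (substλ-sub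
  (λ { zero → refl ; (suc x) → cong wkλ (p x) }) q (λ α → cong (map _) (r α)) M)
substλ-sub p q r (M · N)   = cong₂ _·_ (substλ-sub p q r M) (substλ-sub p q r N)
substλ-sub p q r (μ M)     = cong μ (substλ-sub (λ x → cong wkμ (p x))
  (λ { zero → refl ; (suc α) → cong suc (q α) })
  (λ { zero → refl ; (suc α) → cong (map _) (r α) }) M)
substλ-sub p q r ([ α ] M) = cong₂ [_]_ (q α) (cong₂ plug (r α) (substλ-sub p q r M))

-- Contraction of redexes as simultaneous substitution

_[_=⟨_⟩_] : Term l m → Fin m → Side → Term l m → Term l m
M [ α =⟨ left  ⟩ N ] = M [ α =ᵣ N ]
M [ α =⟨ right ⟩ N ] = M [ α =ₗ N ]

-- A pointwise description, unlike a fixed substitution, is stable under lifting through both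
-- binders.
record Struct (S : Sub l m l m) (α : Fin m) (s : Side) (N : Term l m) : Set where
  constructor struct
  field
    tm-id : tm S ≗ var
    nm-id : nm S ≗ id
    at    : cx S α ≡ (s , N) ∷ []
    off   : ∀ β → ¬ β ≡ α → cx S β ≡ []

Struct-⇑λ : ∀ {S : Sub l m l m} {α s N} → Struct S α s N → Struct (⇑λ S) α s (wkλ N)
Struct-⇑λ (struct p q a o) = struct
  (λ { zero → refl ; (suc x) → cong wkλ (p x) }) q (cong (map _) a) (λ β ne → cong (map _) (o β ne))

Struct-⇑μ : ∀ {S : Sub l m l m} {α s N} → Struct S α s N → Struct (⇑μ S) (suc α) s (wkμ N)
Struct-⇑μ (struct p q a o) = struct
  (λ x → cong wkμ (p x)) (λ { zero → refl ; (suc β) → cong suc (q β) }) (cong (map _) a)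
  (λ { zero _ → refl ; (suc β) ne → cong (map _) (o β (ne ∘ cong suc)) })

struct-sub : ∀ {S : Sub l m l m} {α s N} → Struct S α s N →
  ∀ M → sub S M ≡ M [ α =⟨ s ⟩ N ]
struct-sub {s = left}  S (var x) = Struct.tm-id S x
struct-sub {s = right} S (var x) = Struct.tm-id S x
struct-sub {s = left}  S (ƛ M)   = cong ƛ (struct-sub (Struct-⇑λ S) M)
struct-sub {s = right} S (ƛ M)   = cong ƛ (struct-sub (Struct-⇑λ S) M)
struct-sub {s = left}  S (M · N) = cong₂ _·_ (struct-sub S M) (struct-sub S N)
struct-sub {s = right} S (M · N) = cong₂ _·_ (struct-sub S M) (struct-sub S N)
struct-sub {s = left}  S (μ M)   = cong μ (struct-sub (Struct-⇑μ S) M)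
struct-sub {s = right} S (μ M)   = cong μ (struct-sub (Struct-⇑μ S) M)
struct-sub {α = α} {left} S ([ β ] M) with β ≟ α
... | yes refl = cong₂ [_]_ (Struct.nm-id S β) (cong₂ plug (Struct.at S) (struct-sub S M))
... | no ne    = cong₂ [_]_ (Struct.nm-id S β) (cong₂ plug (Struct.off S β ne) (struct-sub S M))
struct-sub {α = α} {right} S ([ β ] M) with β ≟ α
... | yes refl = cong₂ [_]_ (Struct.nm-id S β) (cong₂ plug (Struct.at S) (struct-sub S M))
... | no ne    = cong₂ [_]_ (Struct.nm-id S β) (cong₂ plug (Struct.off S β ne) (struct-sub S M))

β-sub : Term l m → Sub (suc l) m l m
β-sub N = ⟪ single N , id , (λ _ → []) ⟫

μ-sub : Side → Term l m → Sub l (suc m) l (suc m)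
μ-sub s N = ⟪ var , id , push ((s , wkμ N) ∷ []) (λ _ → []) ⟫

β-sub≡ : ∀ {N : Term l m} M → sub (β-sub N) M ≡ M [x≔ N ]
β-sub≡ = substλ-sub (λ _ → refl) (λ _ → refl) (λ _ → refl)

μ-sub≡ : ∀ s {N : Term l m} M → sub (μ-sub s N) M ≡ M [ zero =⟨ s ⟩ wkμ N ]
μ-sub≡ s = struct-sub (struct (λ _ → refl) (λ _ → refl) refl
  (λ { zero ne → contradiction refl ne ; (suc _) _ → refl }))

map-onTerm-cancel : ∀ {f : Term l m → Term l′ m′} {g : Term l m → Term l″ m″} {h} →
  (∀ X → h (f X) ≡ g X) →
  ∀ fs → map (onTerm h) (map (onTerm f) fs) ++ [] ≡ map (onTerm g) fs
map-onTerm-cancel eq fs = trans (++-identityʳ _) (trans (sym (map-∘ fs))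
  (map-cong (λ { (s , X) → cong (s ,_) (eq X) }) fs))

β-sub-wkλ : ∀ {P : Term l m} X → sub (β-sub P) (wkλ X) ≡ X
β-sub-wkλ X = trans (sub-rename (λ _ → refl) (λ _ → refl) (λ _ → refl) X) (sub-ids X)

β-sub-frames : ∀ {P : Term l m} fs →
  map (onTerm (sub (β-sub P))) (map (onTerm wkλ) fs) ++ [] ≡ fs
β-sub-frames fs = trans (map-onTerm-cancel β-sub-wkλ fs) (map-id fs)

-- Both composites are the single substitution `Q`; on the right, `β-sub` undoes the weakening that
-- `⇑λ` applied to the terms and frames of `S`.
sub-β : ∀ {S : Sub l m l′ m′} M {N} →
  sub S (sub (β-sub N) M) ≡ sub (β-sub (sub S N)) (sub (⇑λ S) M)
sub-β {S = S} M {N} = trans (sub-sub {Q = Q} (comp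
    (λ { zero → refl ; (suc x) → refl }) (λ _ → refl) (λ _ → refl)) M)
  (sym (sub-sub (comp
    (λ { zero → refl ; (suc x) → β-sub-wkλ (tm S x) })
    (λ _ → refl)
    (λ α → β-sub-frames (cx S α))) M))
  where Q = ⟪ push (sub S N) (tm S) , nm S , cx S ⟫

μ-sub-wkμ : ∀ {s} {P : Term l m} X → sub (μ-sub s P) (wkμ X) ≡ wkμ X
μ-sub-wkμ X = trans (sub-rename (λ _ → refl) (λ _ → refl) (λ _ → refl) X)
                    (sub-ren (λ _ → refl) (λ _ → refl) (λ _ → refl) X)

μ-sub-frames : ∀ {s} {P : Term l m} fs →
  map (onTerm (sub (μ-sub s P))) (map (onTerm wkμ) fs) ++ [] ≡ map (onTerm wkμ) fs
μ-sub-frames = map-onTerm-cancel μ-sub-wkμ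

-- This keeps instances closed under root steps: contracting an instance of `μ M` against `N` leaves
-- an instance of `M` whose bound variable has gained one frame.
Comp-⇑μ-μ-sub : ∀ {S : Sub l m l′ m′} {s N} →
  Comp (⇑μ S) (μ-sub s N) (⇑μ⟨ (s , wkμ N) ∷ [] ⟩ S)
Comp-⇑μ-μ-sub {S = S} {s} {N} = comp
  (λ x → μ-sub-wkμ (tm S x))
  (λ _ → refl)
  (λ { zero → refl ; (suc α) → μ-sub-frames (cx S α) })

sub-μ : ∀ {S : Sub l m l′ m′} {s} M {N} →
  sub (⇑μ S) (sub (μ-sub s N) M) ≡ sub (μ-sub s (sub S N)) (sub (⇑μ S) M)
sub-μ {S = S} {s} M {N} = trans
  (sub-sub (comp (λ _ → refl) (λ _ → refl)
    (λ { zero → cong (λ X → (s , X) ∷ []) (sub-wkμ N) ; (suc α) → refl })) M)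
  (sym (sub-sub Comp-⇑μ-μ-sub M))

-- Reduction and substitution

infix 4 _▷*_
_▷*_ : Term l m → Term l m → Set
_▷*_ = Star _▷_

▷-infill : ∀ s {N X X′ : Term l m} → X ▷ X′ → infill s N X ▷ infill s N X′
▷-infill left  = ξ-·ˡ
▷-infill right = ξ-·ʳ

▷-plug : ∀ fs {X X′ : Term l m} → X ▷ X′ → plug fs X ▷ plug fs X′
▷-plug []             r = r
▷-plug ((s , N) ∷ fs) r = ▷-plug fs (▷-infill s r)

▷-≡ : {M N P : Term l m} → M ▷ N → N ≡ P → M ▷ P
▷-≡ r refl = r

μ-step : ∀ s {M : Term l (suc m)} {N} → infill s N (μ M) ▷ μ (sub (μ-sub s N) M)
μ-step left  {M} = ▷-≡ μ-red (cong μ (sym (μ-sub≡ left M)))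
μ-step right {M} = ▷-≡ μ′-red (cong μ (sym (μ-sub≡ right M)))

β-step : ∀ (M : Term (suc l) m) {N} → ƛ M · N ▷ sub (β-sub N) M
β-step M = ▷-≡ β-red (sym (β-sub≡ M))

-- A redex remains a redex under `sub S`, so only the contracta have to be compared, which `sub-β`
-- and `sub-μ` do.
▷-sub : ∀ {S : Sub l m l′ m′} {M M′} → M ▷ M′ → sub S M ▷ sub S M′
▷-sub (β-red {M} {N}) = ▷-≡ (β-step _)
  (trans (sym (sub-β M)) (cong (sub _) (β-sub≡ M)))
▷-sub (μ-red {M} {N}) = ▷-≡ (μ-step left)
  (cong μ (trans (sym (sub-μ M)) (cong (sub _) (μ-sub≡ left M))))
▷-sub (μ′-red {M} {N}) = ▷-≡ (μ-step right)
  (cong μ (trans (sym (sub-μ N)) (cong (sub _) (μ-sub≡ right N))))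
▷-sub (ξ-ƛ r)    = ξ-ƛ (▷-sub r)
▷-sub (ξ-·ˡ r)   = ξ-·ˡ (▷-sub r)
▷-sub (ξ-·ʳ r)   = ξ-·ʳ (▷-sub r)
▷-sub (ξ-μ r)    = ξ-μ (▷-sub r)
▷-sub {S = S} (ξ-name {α} r) = ξ-name (▷-plug (cx S α) (▷-sub r))

▷*-sub : ∀ {S : Sub l m l′ m′} {M M′} → M ▷* M′ → sub S M ▷* sub S M′
▷*-sub = gmap _ ▷-sub

▷*-rename : ∀ {ρ : Fin l → Fin l′} {θ : Fin m → Fin m′} {M M′} →
  M ▷* M′ → rename ρ θ M ▷* rename ρ θ M′
▷*-rename {M = M} {M′} rs = subst₂ _▷*_ (eq M) (eq M′) (▷*-sub rs)
  where
  eq : sub (ren _ _) ≗ rename _ _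
  eq = sub-ren (λ _ → refl) (λ _ → refl) (λ _ → refl)

▷*-· : {M M′ N N′ : Term l m} → M ▷* M′ → N ▷* N′ → M · N ▷* M′ · N′
▷*-· rs ss = gmap (_· _) ξ-·ˡ rs ◅◅ gmap (_ ·_) ξ-·ʳ ss

▷*-infill : ∀ s {N N′ X X′ : Term l m} → N ▷* N′ → X ▷* X′ → infill s N X ▷* infill s N′ X′
▷*-infill left  rs ss = ▷*-· ss rs
▷*-infill right rs ss = ▷*-· rs ss

data _⊳_ {l m} : Frame l m → Frame l m → Set where
  onto : ∀ {s N N′} → N ▷* N′ → (s , N) ⊳ (s , N′)

▷*-plug : ∀ {fs gs} {X Y : Term l m} → Pointwise _⊳_ fs gs → X ▷* Y → plug fs X ▷* plug gs Y
▷*-plug []                     rs = rs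
▷*-plug (onto {s} ss ∷ fs⊳gs) rs = ▷*-plug fs⊳gs (▷*-infill s ss rs)

frames-rename : ∀ {ρ : Fin l → Fin l′} {θ : Fin m → Fin m′} {fs gs} →
  Pointwise _⊳_ fs gs →
  Pointwise _⊳_ (map (onTerm (rename ρ θ)) fs) (map (onTerm (rename ρ θ)) gs)
frames-rename []             = []
frames-rename (onto rs ∷ ps) = onto (▷*-rename rs) ∷ frames-rename ps

frames-refl : (fs : List (Frame l m)) → Pointwise _⊳_ fs fs
frames-refl []       = []
frames-refl (f ∷ fs) = onto ε ∷ frames-refl fs

record _⊳ₛ_ (S R : Sub l m l′ m′) : Set where
  constructor mk⊳
  field
    tm⊳ : ∀ x → tm S x ▷* tm R x
    nm⊳ : nm S ≗ nm R
    cx⊳ : ∀ α → Pointwise _⊳_ (cx S α) (cx R α)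
open _⊳ₛ_

⊳-⇑λ : {S R : Sub l m l′ m′} → S ⊳ₛ R → ⇑λ S ⊳ₛ ⇑λ R
⊳-⇑λ p = mk⊳ (λ { zero → ε ; (suc x) → ▷*-rename (tm⊳ p x) }) (nm⊳ p) (λ α → frames-rename (cx⊳ p α))

⊳-⇑μ : {S R : Sub l m l′ m′} → S ⊳ₛ R → ⇑μ S ⊳ₛ ⇑μ R
⊳-⇑μ p = mk⊳ (λ x → ▷*-rename (tm⊳ p x))
  (λ { zero → refl ; (suc α) → cong suc (nm⊳ p α) })
  (λ { zero → [] ; (suc α) → frames-rename (cx⊳ p α) })

sub-mono : {S R : Sub l m l′ m′} → S ⊳ₛ R → ∀ M → sub S M ▷* sub R M
sub-mono p (var x) = tm⊳ p x
sub-mono p (ƛ M)   = gmap ƛ ξ-ƛ (sub-mono (⊳-⇑λ p) M)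
sub-mono p (M · N) = ▷*-· (sub-mono p M) (sub-mono p N)
sub-mono p (μ M)   = gmap μ ξ-μ (sub-mono (⊳-⇑μ p) M)
sub-mono {R = R} p ([ α ] M) rewrite nm⊳ p α =
  gmap [ nm R α ]_ ξ-name (▷*-plug (cx⊳ p α) (sub-mono p M))

β-sub-mono : ∀ {M M′ : Term (suc l) m} {N N′} → M ▷* M′ → N ▷* N′ →
  sub (β-sub N) M ▷* sub (β-sub N′) M′
β-sub-mono {M = M} rs ss =
  sub-mono (mk⊳ (λ { zero → ss ; (suc x) → ε }) (λ _ → refl) (λ _ → [])) M ◅◅ ▷*-sub rs

μ-sub-mono : ∀ s {M M′ : Term l (suc m)} {N N′} → M ▷* M′ → N ▷* N′ →
  sub (μ-sub s N) M ▷* sub (μ-sub s N′) M′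
μ-sub-mono s {M} rs ss =
  sub-mono (mk⊳ (λ x → ε) (λ _ → refl)
    (λ { zero → onto (▷*-rename ss) ∷ [] ; (suc α) → [] })) M ◅◅ ▷*-sub rs

-- Reducts of instances

-- Inst S U T holds if T arises from sub S U by reductions inside the arguments of
-- named subterms. When S maps λ-variables to λ-variables, this makes the reducts of
-- sub S U exactly the instances of reducts of U.
data Inst {l m l′ m′} (S : Sub l m l′ m′) : Term l m → Term l′ m′ → Set where
  var  : ∀ {x T} → T ≡ tm S x → Inst S (var x) T
  ƛ    : ∀ {M T} → Inst (⇑λ S) M T → Inst S (ƛ M) (ƛ T)
  _·_  : ∀ {M N T₁ T₂} → Inst S M T₁ → Inst S N T₂ → Inst S (M · N) (T₁ · T₂)
  μ    : ∀ {M T} → Inst (⇑μ S) M T → Inst S (μ M) (μ T)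
  name : ∀ {α β M T} → β ≡ nm S α → plug (cx S α) (sub S M) ▷* T →
         Inst S ([ α ] M) ([ β ] T)

inst-refl : ∀ {S : Sub l m l′ m′} M → Inst S M (sub S M)
inst-refl (var x)   = var refl
inst-refl (ƛ M)     = ƛ (inst-refl M)
inst-refl (M · N)   = inst-refl M · inst-refl N
inst-refl (μ M)     = μ (inst-refl M)
inst-refl ([ α ] M) = name refl ε

inst⇒▷* : ∀ {S : Sub l m l′ m′} {M T} → Inst S M T → sub S M ▷* T
inst⇒▷* (var refl)     = ε
inst⇒▷* (ƛ i)          = gmap ƛ ξ-ƛ (inst⇒▷* i)
inst⇒▷* (i · j)        = ▷*-· (inst⇒▷* i) (inst⇒▷* j)
inst⇒▷* (μ i)          = gmap μ ξ-μ (inst⇒▷* i)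
inst⇒▷* (name refl rs) = gmap [ _ ]_ ξ-name rs

inst-rename : ∀ {l₁ m₁ l₂ m₂} {S : Sub l m l′ m′} {S′ : Sub l₁ m₁ l₂ m₂}
  {ρ : Fin l → Fin l₁} {θ : Fin m → Fin m₁} {ρ′ : Fin l′ → Fin l₂} {θ′ : Fin m′ → Fin m₂} →
  tm S′ ∘ ρ ≗ rename ρ′ θ′ ∘ tm S → nm S′ ∘ θ ≗ θ′ ∘ nm S →
  cx S′ ∘ θ ≗ map (onTerm (rename ρ′ θ′)) ∘ cx S →
  ∀ {M T} → Inst S M T → Inst S′ (rename ρ θ M) (rename ρ′ θ′ T)
inst-rename p q r (var refl) = var (sym (p _))
inst-rename {S = S} p q r (ƛ i) = ƛ (inst-rename
  (λ { zero → refl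
     ; (suc x) → trans (cong wkλ (p x)) (rename-comm (λ _ → refl) (λ _ → refl) (tm S x)) })
  q
  (λ α → trans (cong (map _) (r α)) (frames-comm (rename-comm (λ _ → refl) (λ _ → refl)) (cx S α))) i)
inst-rename p q r (i · j) = inst-rename p q r i · inst-rename p q r j
inst-rename {S = S} p q r (μ i) = μ (inst-rename
  (λ x → trans (cong wkμ (p x)) (rename-comm (λ _ → refl) (λ _ → refl) (tm S x)))
  (λ { zero → refl ; (suc α) → cong suc (q α) })
  (λ { zero → refl
     ; (suc α) → trans (cong (map _) (r α))
                   (frames-comm (rename-comm (λ _ → refl) (λ _ → refl)) (cx S α)) }) i)
inst-rename {S = S} p q r (name {α} {M = M} refl rs) = name (sym (q α))
  (subst (_▷* _)
    (trans (rename-plug (cx S α)) (cong₂ plug (sym (r α))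
      (trans (rename-sub (λ _ → refl) (λ _ → refl) (λ _ → refl) M) (sym (sub-rename p q r M)))))
    (▷*-rename rs))

-- Commutation up to reduction: `R` acts on the source, `R′` on the instance. Equality of frames
-- would be too strong, since a contraction may insert a term that has already been reduced in the
-- instance but not in the source.
record Square {l₁ m₁ l₂ m₂} (S : Sub l m l′ m′) (S′ : Sub l₁ m₁ l₂ m₂)
              (R : Sub l m l₁ m₁) (R′ : Sub l′ m′ l₂ m₂) : Set where
  constructor square
  field
    tm-inst : ∀ x → Inst S′ (tm R x) (sub R′ (tm S x))
    nm-comm : ∀ α → nm R′ (nm S α) ≡ nm S′ (nm R α)
    cx-red  : ∀ α → Pointwise _⊳_ (map (onTerm (sub S′)) (cx R α) ++ cx S′ (nm R α))
                                  (map (onTerm (sub R′)) (cx S α) ++ cx R′ (nm S α))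
open Square

module _ {l₁ m₁ l₂ m₂} {S : Sub l m l′ m′} {S′ : Sub l₁ m₁ l₂ m₂}
         {R : Sub l m l₁ m₁} {R′ : Sub l′ m′ l₂ m₂} where

  Square-⇑λ : Square S S′ R R′ → Square (⇑λ S) (⇑λ S′) (⇑λ R) (⇑λ R′)
  Square-⇑λ sq = square
    (λ { zero → var refl
       ; (suc x) → subst (Inst _ _) (sym (sub-wkλ (tm S x)))
           (inst-rename (λ _ → refl) (λ _ → refl) (λ _ → refl) (tm-inst sq x)) })
    (nm-comm sq)
    (λ α → subst₂ (Pointwise _⊳_) (eq (cx R α)) (eq (cx S α)) (frames-rename (cx-red sq α)))
    where
    eq : ∀ {l m l′ m′} {Q : Sub l m l′ m′} fs {gs} →
      map (onTerm wkλ) (map (onTerm (sub Q)) fs ++ gs) ≡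
      map (onTerm (sub (⇑λ Q))) (map (onTerm wkλ) fs) ++ map (onTerm wkλ) gs
    eq fs = trans (map-++ _ (map _ fs) _) (cong (_++ _) (sym (frames-comm sub-wkλ fs)))

  Square-⇑μ : Square S S′ R R′ → Square (⇑μ S) (⇑μ S′) (⇑μ R) (⇑μ R′)
  Square-⇑μ sq = square
    (λ x → subst (Inst _ _) (sym (sub-wkμ (tm S x)))
       (inst-rename (λ _ → refl) (λ _ → refl) (λ _ → refl) (tm-inst sq x)))
    (λ { zero → refl ; (suc α) → cong suc (nm-comm sq α) })
    (λ { zero → []
       ; (suc α) → subst₂ (Pointwise _⊳_) (eq (cx R α)) (eq (cx S α)) (frames-rename (cx-red sq α)) })
    where
    eq : ∀ {l m l′ m′} {Q : Sub l m l′ m′} fs {gs} →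
      map (onTerm wkμ) (map (onTerm (sub Q)) fs ++ gs) ≡
      map (onTerm (sub (⇑μ Q))) (map (onTerm wkμ) fs) ++ map (onTerm wkμ) gs
    eq fs = trans (map-++ _ (map _ fs) _) (cong (_++ _) (sym (frames-comm sub-wkμ fs)))

_⨟_ : Sub l m l′ m′ → Sub l′ m′ l″ m″ → Sub l m l″ m″
S ⨟ R = ⟪ sub R ∘ tm S , nm R ∘ nm S , (λ α → map (onTerm (sub R)) (cx S α) ++ cx R (nm S α)) ⟫

plug-⨟ : ∀ (S : Sub l m l′ m′) (R : Sub l′ m′ l″ m″) α M →
  plug (cx R (nm S α)) (sub R (plug (cx S α) (sub S M))) ≡ plug (cx (S ⨟ R) α) (sub (S ⨟ R) M)
plug-⨟ S R α M = trans (cong (plug (cx R (nm S α))) (sub-plug (cx S α)))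
  (trans (sym (plug-++ (map (onTerm (sub R)) (cx S α))))
         (cong (plug (cx (S ⨟ R) α)) (sub-sub (comp (λ _ → refl) (λ _ → refl) (λ _ → refl)) M)))

inst-sub : ∀ {l₁ m₁ l₂ m₂} {S : Sub l m l′ m′} {S′ : Sub l₁ m₁ l₂ m₂}
  {R : Sub l m l₁ m₁} {R′ : Sub l′ m′ l₂ m₂} → Square S S′ R R′ →
  ∀ {M T} → Inst S M T → Inst S′ (sub R M) (sub R′ T)
inst-sub sq (var refl) = tm-inst sq _
inst-sub sq (ƛ i)      = ƛ (inst-sub (Square-⇑λ sq) i)
inst-sub sq (i · j)    = inst-sub sq i · inst-sub sq j
inst-sub sq (μ i)      = μ (inst-sub (Square-⇑μ sq) i)
inst-sub {S = S} {S′} {R} {R′} sq (name {α} {M = M} refl rs) =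
  name (nm-comm sq α)
    (subst₂ _▷*_ (sym (plug-⨟ R S′ α M)) (sym (plug-⨟ S R′ α M))
       (▷*-plug (cx-red sq α) (sub-mono ⨟⊳ M))
     ◅◅ ▷*-plug (frames-refl (cx R′ (nm S α))) (▷*-sub rs))
  where
  ⨟⊳ : (R ⨟ S′) ⊳ₛ (S ⨟ R′)
  ⨟⊳ = mk⊳ (λ x → inst⇒▷* (tm-inst sq x)) (λ β → sym (nm-comm sq β)) (cx-red sq)

-- Under such a substitution new redexes arise only from frames, hence only inside arguments of
-- named subterms.
record IsRen (S : Sub l m l′ m′) : Set where
  constructor isRen
  field
    tm-var : ∀ x → ∃ λ y → tm S x ≡ var y
open IsRen

IsRen-⇑λ : {S : Sub l m l′ m′} → IsRen S → IsRen (⇑λ S)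
IsRen-⇑λ r = isRen λ { zero → zero , refl ; (suc x) → _ , cong wkλ (proj₂ (tm-var r x)) }

IsRen-⇑μ : ∀ {S : Sub l m l′ m′} {fs} → IsRen S → IsRen (⇑μ⟨ fs ⟩ S)
IsRen-⇑μ r = isRen λ x → _ , cong wkμ (proj₂ (tm-var r x))

inst-β : ∀ {S : Sub l m l′ m′} {M N T₁ T₂} → Inst (⇑λ S) M T₁ → Inst S N T₂ →
  Inst S (sub (β-sub N) M) (sub (β-sub T₂) T₁)
inst-β {S = S} i j = inst-sub (square
  (λ { zero → j ; (suc x) → var (β-sub-wkλ (tm S x)) })
  (λ _ → refl)
  (λ α → subst (Pointwise _⊳_ _) (sym (β-sub-frames (cx S α))) (frames-refl _))) i

inst-μ : ∀ {S : Sub l m l′ m′} {s M N T₁ T₂} → Inst (⇑μ S) M T₁ → Inst S N T₂ →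
  Inst (⇑μ S) (sub (μ-sub s N) M) (sub (μ-sub s T₂) T₁)
inst-μ {S = S} {N = N} i j = inst-sub (square
  (λ x → var (μ-sub-wkμ (tm S x)))
  (λ _ → refl)
  -- The frame inserted in the source holds `N`, whose instance merely reduces to `T₂`.
  (λ { zero → onto (subst (_▷* _) (sym (sub-wkμ N)) (▷*-rename (inst⇒▷* j))) ∷ []
     ; (suc α) → subst (Pointwise _⊳_ _) (sym (μ-sub-frames (cx S α))) (frames-refl _) })) i

-- A step inside the argument of a named subterm is absorbed by `name` and costs no step of `M`. Any
-- other redex has its head constructors already in `M`, because λ-variables go to variables, and is
-- contracted there too.
inst-step : ∀ {S : Sub l m l′ m′} {M T T′} → IsRen S → Inst S M T → T ▷ T′ →
  ∃ λ M′ → M ▷* M′ × Inst S M′ T′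
inst-step isr (var {x} eq) r with trans eq (proj₂ (tm-var isr x))
inst-step isr (var eq) () | refl
inst-step isr (ƛ i) (ξ-ƛ r) with inst-step (IsRen-⇑λ isr) i r
... | M′ , rs , i′ = ƛ M′ , gmap ƛ ξ-ƛ rs , ƛ i′
inst-step isr (μ i) (ξ-μ r) with inst-step (IsRen-⇑μ isr) i r
... | M′ , rs , i′ = μ M′ , gmap μ ξ-μ rs , μ i′
inst-step isr (name eq rs) (ξ-name r) = _ , ε , name eq (rs ◅◅ r ◅ ε)
inst-step isr (i · j) (ξ-·ˡ r) with inst-step isr i r
... | M′ , rs , i′ = _ , gmap (_· _) ξ-·ˡ rs , i′ · j
inst-step isr (i · j) (ξ-·ʳ r) with inst-step isr j r
... | N′ , rs , j′ = _ , gmap (_ ·_) ξ-·ʳ rs , i · j′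
inst-step isr (var {x} eq · j) β-red with trans eq (proj₂ (tm-var isr x))
... | ()
inst-step isr (ƛ {M} {T} i · j) β-red =
  _ , β-step M ◅ ε , subst (Inst _ _) (β-sub≡ T) (inst-β i j)
inst-step isr (var {x} eq · j) μ-red with trans eq (proj₂ (tm-var isr x))
... | ()
inst-step isr (μ {M} {T} i · j) μ-red =
  _ , μ-step left ◅ ε , μ (subst (Inst _ _) (μ-sub≡ left T) (inst-μ i j))
inst-step isr (i · var {x} eq) μ′-red with trans eq (proj₂ (tm-var isr x))
... | ()
inst-step isr (i · μ {M} {T} j) μ′-red =
  _ , μ-step right ◅ ε , μ (subst (Inst _ _) (μ-sub≡ right T) (inst-μ j i))

inst-steps : ∀ {S : Sub l m l′ m′} {M T T′} → IsRen S → Inst S M T → T ▷* T′ →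
  ∃ λ M′ → M ▷* M′ × Inst S M′ T′
inst-steps isr i ε = _ , ε , i
inst-steps isr i (r ◅ rs) with inst-step isr i r
... | _ , ss , i′ with inst-steps isr i′ rs
... | M′ , ss′ , i″ = M′ , ss ◅◅ ss′ , i″

reflect-ƛ : ∀ {S : Sub l m l′ m′} M {P} → IsRen S → sub S M ▷* ƛ P →
  ∃ λ Q → M ▷* ƛ Q × sub (⇑λ S) Q ▷* P
reflect-ƛ M isr rs with inst-steps isr (inst-refl M) rs
... | _ , _  , var {x} eq with () ← trans eq (proj₂ (tm-var isr x))
... | _ , ss , ƛ i = _ , ss , inst⇒▷* i

reflect-μ : ∀ {S : Sub l m l′ m′} M {P} → IsRen S → sub S M ▷* μ P →
  ∃ λ Q → M ▷* μ Q × sub (⇑μ S) Q ▷* P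
reflect-μ M isr rs with inst-steps isr (inst-refl M) rs
... | _ , _  , var {x} eq with () ← trans eq (proj₂ (tm-var isr x))
... | _ , ss , μ i = _ , ss , inst⇒▷* i

-- Strong normalization

SN-reduct : {M N : Term l m} → SN M → M ▷* N → SN N
SN-reduct sn       ε        = sn
SN-reduct (acc rs) (r ◅ ss) = SN-reduct (rs r) ss

SN-reflect : (f : Term l m → Term l′ m′) → (∀ {M N} → M ▷ N → f M ▷ f N) →
  ∀ {M} → SN (f M) → SN M
SN-reflect f mono (acc rs) = acc λ r → SN-reflect f mono (rs (mono r))

SN-ƛ : {M : Term (suc l) m} → SN M → SN (ƛ M)
SN-ƛ (acc rs) = acc λ { (ξ-ƛ r) → SN-ƛ (rs r) }

SN-μ : {M : Term l (suc m)} → SN M → SN (μ M)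
SN-μ (acc rs) = acc λ { (ξ-μ r) → SN-μ (rs r) }

SN-name : ∀ {α} {M : Term l m} → SN M → SN ([ α ] M)
SN-name (acc rs) = acc λ { (ξ-name r) → SN-name (rs r) }

-- Induction on both accessibility proofs. The hypotheses range over all reducts of one component
-- with the other fixed; a step in the fixed component only reduces the contractum, so they persist.
SN-· : {M N : Term l m} → SN M → SN N →
  (∀ {P} → M ▷* ƛ P → SN (sub (β-sub N) P)) →
  (∀ {P} → M ▷* μ P → SN (sub (μ-sub left N) P)) →
  (∀ {P} → N ▷* μ P → SN (sub (μ-sub right M) P)) →
  SN (M · N)
SN-· {M = M} {N} snM@(acc rsM) snN@(acc rsN) hβ hμ hμ′ = acc reduct
  where
  reduct : ∀ {T} → M · N ▷ T → SN T
  reduct (β-red {P}) = subst SN (β-sub≡ P) (hβ ε)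
  reduct (μ-red {P}) = SN-μ (subst SN (μ-sub≡ left P) (hμ ε))
  reduct (μ′-red {_} {P}) = SN-μ (subst SN (μ-sub≡ right P) (hμ′ ε))
  reduct (ξ-·ˡ r) = SN-· (rsM r) snN (λ ss → hβ (r ◅ ss)) (λ ss → hμ (r ◅ ss))
    (λ {P} ss → SN-reduct (hμ′ ss) (μ-sub-mono right {P} ε (r ◅ ε)))
  reduct (ξ-·ʳ r) = SN-· snM (rsN r)
    (λ {P} ss → SN-reduct (hβ ss) (β-sub-mono {M = P} ε (r ◅ ε)))
    (λ {P} ss → SN-reduct (hμ ss) (μ-sub-mono left {P} ε (r ◅ ε)))
    (λ ss → hμ′ (r ◅ ss))

-- Reduction combined with passage to subterms

infix 4 _↝_
data _↝_ : ∀ {l m l′ m′} → Term l m → Term l′ m′ → Set where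
  red     : {M N : Term l m} → M ▷ N → M ↝ N
  in-ƛ    : {M : Term (suc l) m} → ƛ M ↝ M
  in-·ˡ   : {M N : Term l m} → M · N ↝ M
  in-·ʳ   : {M N : Term l m} → M · N ↝ N
  in-μ    : {M : Term l (suc m)} → μ M ↝ M
  in-name : ∀ {α} {M : Term l m} → [ α ] M ↝ M

-- Accessibility for ↝, which relates terms over different scopes.
data Wf {l m} (M : Term l m) : Set where
  wf : (∀ {l′ m′} {N : Term l′ m′} → M ↝ N → Wf N) → Wf M

-- A reduction inside a subterm is a reduction of the whole term, here C M.
SN⇒Wf-in : (C : Term l m → Term l′ m′) → (∀ {M N} → M ▷ N → C M ▷ C N) →
  ∀ M → SN (C M) → Wf M
SN⇒Wf-in C mono M sn@(acc rs) = wf (next M sn)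
  where
  next : ∀ M → SN (C M) → ∀ {l″ m″} {N : Term l″ m″} → M ↝ N → Wf N
  next M (acc rs) (red r) = SN⇒Wf-in C mono _ (rs (mono r))
  next _ sn in-ƛ    = SN⇒Wf-in (C ∘ ƛ) (mono ∘ ξ-ƛ) _ sn
  next _ sn (in-·ˡ {N = N}) = SN⇒Wf-in (λ X → C (X · N)) (mono ∘ ξ-·ˡ) _ sn
  next _ sn (in-·ʳ {M = M}) = SN⇒Wf-in (λ X → C (M · X)) (mono ∘ ξ-·ʳ) _ sn
  next _ sn in-μ    = SN⇒Wf-in (C ∘ μ) (mono ∘ ξ-μ) _ sn
  next _ sn (in-name {α = α}) = SN⇒Wf-in (C ∘ [ α ]_) (mono ∘ ξ-name) _ sn

SN⇒Wf : {M : Term l m} → SN M → Wf M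
SN⇒Wf = SN⇒Wf-in id id _

Wf-▷* : {M N : Term l m} → M ▷* N → Wf M → Wf N
Wf-▷* ε        w      = w
Wf-▷* (r ◅ rs) (wf h) = Wf-▷* rs (h (red r))

-- Neutral terms

-- Fit true says that M stays neutral: neither M nor, if M reduces to μ α M′, an argument
-- of α reduces to an abstraction. In Fit b Γ Δ M, the μ-variables marked by Γ are those
-- whose arguments have to stay neutral, the λ-variables marked by Δ those that count as
-- neutral. Fit false concerns only the arguments of the marked variables.
Fit : Bool → (Fin m → Bool) → (Fin l → Bool) → Term l m → Set
Fit b Γ Δ (var x)   = T b → T (Δ x)
Fit b Γ Δ (ƛ M)     = ¬ T b × Fit false Γ (push false Δ) M
Fit b Γ Δ (M · N)   = Fit b Γ Δ M × Fit false Γ Δ N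
Fit b Γ Δ (μ M)     = Fit false (push b Γ) Δ M
Fit b Γ Δ ([ α ] M) = Fit (Γ α) Γ Δ M

Fit-rename : ∀ {b b′} {Γ : Fin m → Bool} {Γ′ : Fin m′ → Bool} {Δ : Fin l → Bool} {Δ′ : Fin l′ → Bool}
  {ρ θ} → (T b′ → T b) → (∀ α → T (Γ′ (θ α)) → T (Γ α)) → (∀ x → T (Δ x) → T (Δ′ (ρ x))) →
  ∀ M → Fit b Γ Δ M → Fit b′ Γ′ Δ′ (rename ρ θ M)
Fit-rename p q r (var x) f         = r x ∘ f ∘ p
Fit-rename p q r (ƛ M) (nb , f)    =
  nb ∘ p , Fit-rename id q (λ { zero () ; (suc x) → r x }) M f
Fit-rename p q r (M · N) (f , g)   = Fit-rename p q r M f , Fit-rename id q r N g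
Fit-rename p q r (μ M) f           = Fit-rename id (λ { zero → p ; (suc α) → q α }) r M f
Fit-rename p q r ([ α ] M) f       = Fit-rename (q α) q r M f

Fit-weaken : ∀ {b b′} {Γ : Fin m → Bool} {Δ : Fin l → Bool} → (T b′ → T b) →
  ∀ M → Fit b Γ Δ M → Fit b′ Γ Δ M
Fit-weaken p M f = subst (Fit _ _ _) (rename-id (λ _ → refl) (λ _ → refl) M)
  (Fit-rename p (λ _ → id) (λ _ → id) M f)

-- Demands originate from the flag and from marked μ-variables only; with neither present, `push`
-- under `μ` creates no new mark.
Fit-false : ∀ {Γ : Fin m → Bool} {Δ : Fin l → Bool} → (∀ α → ¬ T (Γ α)) →
  ∀ M → Fit false Γ Δ M
Fit-false q (var x)   ()
Fit-false q (ƛ M)     = id , Fit-false q M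
Fit-false q (M · N)   = Fit-false q M , Fit-false q N
Fit-false q (μ M)     = Fit-false (λ { zero → id ; (suc α) → q α }) M
Fit-false q ([ α ] M) = Fit-weaken (q α) M (Fit-false q M)

-- Frames that turn an argument of grade g into one of grade g′.
data FitFrames (g g′ : Bool) (Γ : Fin m → Bool) (Δ : Fin l → Bool) : List (Frame l m) → Set where
  none  : (T g′ → T g) → FitFrames g g′ Γ Δ []
  left  : ∀ {N} → (T g′ → T g) → Fit false Γ Δ N → FitFrames g g′ Γ Δ ((left , N) ∷ [])
  right : ∀ {N} → Fit g′ Γ Δ N → FitFrames g g′ Γ Δ ((right , N) ∷ [])

FitFrames-rename : ∀ {g g′} {Γ : Fin m → Bool} {Γ′ : Fin m′ → Bool} {Δ : Fin l → Bool} {Δ′ : Fin l′ → Bool}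
  {ρ θ} → (∀ α → T (Γ′ (θ α)) → T (Γ α)) → (∀ x → T (Δ x) → T (Δ′ (ρ x))) →
  ∀ {fs} → FitFrames g g′ Γ Δ fs → FitFrames g g′ Γ′ Δ′ (map (onTerm (rename ρ θ)) fs)
FitFrames-rename q r (none p)       = none p
FitFrames-rename q r (left {N} p f) = left p (Fit-rename id q r N f)
FitFrames-rename q r (right {N} f)  = right (Fit-rename id q r N f)

-- Neutrality of an application is that of its function part: the hole supplies it in a left frame,
-- the stored term in a right frame.
Fit-plug : ∀ {g g′} {Γ : Fin m → Bool} {Δ : Fin l → Bool} {fs} →
  FitFrames g g′ Γ Δ fs → ∀ X → Fit g Γ Δ X → Fit g′ Γ Δ (plug fs X)
Fit-plug (none p)   X f = Fit-weaken p X f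
Fit-plug (left p g) X f = Fit-weaken p X f , g
Fit-plug (right g)  X f = g , Fit-weaken (λ ()) X f

Fit-sub : ∀ {b} {Γ : Fin m → Bool} {Γ′ : Fin m′ → Bool} {Δ : Fin l → Bool} {Δ′ : Fin l′ → Bool}
  {S : Sub l m l′ m′} → (∀ x → Fit (Δ x) Γ′ Δ′ (tm S x)) →
  (∀ α → FitFrames (Γ α) (Γ′ (nm S α)) Γ′ Δ′ (cx S α)) →
  ∀ M → Fit b Γ Δ M → Fit b Γ′ Δ′ (sub S M)
Fit-sub {S = S} t c (var x) f = Fit-weaken f (tm S x) (t x)
Fit-sub {S = S} t c (ƛ M) (nb , f) = nb , Fit-sub
  (λ { zero () ; (suc x) → Fit-rename id (λ _ → id) (λ _ → id) (tm S x) (t x) })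
  (λ α → FitFrames-rename (λ _ → id) (λ _ → id) (c α)) M f
Fit-sub t c (M · N) (f , g) = Fit-sub t c M f , Fit-sub t c N g
Fit-sub {S = S} t c (μ M) f = Fit-sub
  (λ x → Fit-rename id (λ _ → id) (λ _ → id) (tm S x) (t x))
  (λ { zero → none id ; (suc α) → FitFrames-rename (λ _ → id) (λ _ → id) (c α) }) M f
Fit-sub t c ([ α ] M) f = Fit-plug (c α) (sub _ M) (Fit-sub t c M f)

-- A β-redex is fit only where neutrality is not demanded, and its bound variable does not count as
-- neutral, so any fit argument may replace it. In a μ-step the marked arguments move to function
-- position and stay neutral; in a μ′-step the new mark is justified by `M`, which becomes the
-- function part.
Fit-▷ : ∀ {b} {Γ : Fin m → Bool} {Δ : Fin l → Bool} {M M′} → M ▷ M′ → Fit b Γ Δ M → Fit b Γ Δ M′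
Fit-▷ (β-red {M} {N}) ((nb , f) , g) = subst (Fit _ _ _) (β-sub≡ M)
  (Fit-weaken {b = false} nb (sub (β-sub N) M) (Fit-sub (λ { zero → g ; (suc x) → id }) (λ _ → none id) M f))
Fit-▷ (μ-red {M} {N}) (f , g) = subst (Fit _ _ _) (μ-sub≡ left M)
  (Fit-sub (λ _ → id)
    (λ { zero → left id (Fit-rename id (λ _ → id) (λ _ → id) N g) ; (suc _) → none id }) M f)
Fit-▷ (μ′-red {M} {N}) (f , g) = subst (Fit _ _ _) (μ-sub≡ right N)
  (Fit-sub (λ _ → id)
    (λ { zero → right (Fit-rename id (λ _ → id) (λ _ → id) M f) ; (suc _) → none id }) N g)
Fit-▷ (ξ-ƛ r) (nb , f)   = nb , Fit-▷ r f
Fit-▷ (ξ-·ˡ r) (f , g)   = Fit-▷ r f , g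
Fit-▷ (ξ-·ʳ r) (f , g)   = f , Fit-▷ r g
Fit-▷ (ξ-μ r) f          = Fit-▷ r f
Fit-▷ (ξ-name r) f       = Fit-▷ r f

Fit-▷* : ∀ {b} {Γ : Fin m → Bool} {Δ : Fin l → Bool} {M M′} → M ▷* M′ → Fit b Γ Δ M → Fit b Γ Δ M′
Fit-▷* ε        f = f
Fit-▷* (r ◅ rs) f = Fit-▷* rs (Fit-▷ r f)

-- The logical relation

-- The term in the hole has to stay neutral when it is in function position.
grade : Side → Bool
grade left  = true
grade right = false

-- A μ-variable gets its only frame when its binder meets the other component at the root. The side
-- condition ensures that arguments landing in function position are marked as neutral.
data Framed (P : Term l m → Set) (s : Side) (g : Bool) : List (Frame l m) → Set where
  none : Framed P s g []
  one  : ∀ {N} → (T (grade s) → T g) → P N → Framed P s g ((s , N) ∷ [])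

record Instance (P : Term l′ m′ → Set) (s : Side) (b : Bool)
                (Γ : Fin m → Bool) (Δ : Fin l → Bool)
                (S : Sub l m l′ m′) (M : Term l m) : Set where
  constructor instance′
  field
    isren  : IsRen S
    fit    : Fit b Γ Δ M
    framed : ∀ α → Framed P s (Γ α) (cx S α)
open Instance

-- Ok s w N, for w : Wf M, says that N may be put around every instance of every proper
-- ↝-descendant of M, provided that the frames of the instance satisfy the same condition
-- with respect to that descendant.
Ok : Side → {M : Term l m} → Wf M → Term l′ m′ → Set
Ok s {M} (wf h) N = ∀ {l₁ m₁} {M′ : Term l₁ m₁} (r : M ↝ M′) →
  Ok s (h r) N ×
  (∀ {l₂ m₂} ρ θ {S : Sub l₁ m₁ l₂ m₂} {Γ Δ} →
    Instance (Ok s (h r)) s (grade s) Γ Δ S M′ → SN (infill s (rename ρ θ N) (sub S M′)))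

-- The renamings quantified over in `Ok` serve this closure, needed because frames are weakened
-- under binders.
Ok-rename : ∀ {s} {M : Term l m} (w : Wf M) {ρ : Fin l′ → Fin l″} {θ : Fin m′ → Fin m″} {N} →
  Ok s w N → Ok s w (rename ρ θ N)
Ok-rename {s = s} (wf h) {N = N} ok r = Ok-rename (h r) (proj₁ (ok r)) , λ ρ θ {S} i →
  subst (λ X → SN (infill s X _)) (sym (rename-fuse (λ _ → refl) (λ _ → refl) N))
    (proj₂ (ok r) _ _ i)

Ok-▷* : ∀ {s} {M M′ : Term l m} {N : Term l′ m′} (rs : M ▷* M′) (w : Wf M) →
  Ok s w N → Ok s (Wf-▷* rs w) N
Ok-▷* ε        w      ok = ok
Ok-▷* (r ◅ rs) (wf h) ok = Ok-▷* rs (h (red r)) (proj₁ (ok (red r)))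

Framed-map : ∀ {P : Term l m → Set} {P′ : Term l′ m′ → Set} {f s g} →
  (∀ {N} → P N → P′ (f N)) → ∀ {fs} → Framed P s g fs → Framed P′ s g (map (onTerm f) fs)
Framed-map h none      = none
Framed-map h (one p x) = one p (h x)

Framed-⊆ : ∀ {P P′ : Term l m → Set} {s g} →
  (∀ {N} → P N → P′ N) → ∀ {fs} → Framed P s g fs → Framed P′ s g fs
Framed-⊆ h none      = none
Framed-⊆ h (one p x) = one p (h x)

Instance-rename : ∀ {l₁ m₁ s b Γ Δ} {M : Term l₁ m₁} {S : Sub l m l′ m′}
  {ρ : Fin l′ → Fin l″} {θ : Fin m′ → Fin m″} {N} (w : Wf M) →
  Instance (Ok s w) s b Γ Δ S N →
  Instance (Ok s w) s b Γ Δ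
    ⟪ rename ρ θ ∘ tm S , θ ∘ nm S , map (onTerm (rename ρ θ)) ∘ cx S ⟫ N
Instance-rename w (instance′ r f c) = instance′
  (isRen λ x → _ , cong (rename _ _) (proj₂ (tm-var r x))) f
  (λ α → Framed-map (Ok-rename w) (c α))

-- Induction on `w`. A framed leaf is exactly what `Ok` covers at `in-name`; at an application,
-- every root redex of a reduct is traced back to a reduct of the source.
SN-instance : ∀ {s b Γ Δ} {M : Term l m} {S : Sub l m l′ m′} (w : Wf M) →
  Instance (Ok s w) s b Γ Δ S M → SN (sub S M)
SN-instance {M = var x} w i rewrite proj₂ (tm-var (isren i) x) = acc λ ()
SN-instance {M = ƛ M} (wf h) (instance′ r f c) = SN-ƛ (SN-instance (h in-ƛ) (instance′
  (IsRen-⇑λ r) (proj₂ f)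
  (λ α → Framed-map (λ ok → Ok-rename (h in-ƛ) (proj₁ (ok in-ƛ))) (c α))))
SN-instance {M = μ M} (wf h) (instance′ r f c) = SN-μ (SN-instance (h in-μ) (instance′
  (IsRen-⇑μ r) f
  (λ { zero → none
     ; (suc α) → Framed-map (λ ok → Ok-rename (h in-μ) (proj₁ (ok in-μ))) (c α) })))
SN-instance {s = s} {Γ = Γ} {Δ} {M = [ α ] M} {S} (wf h) (instance′ r f c) = SN-name (leaf (c α))
  where
  c′ : ∀ β → Framed (Ok s (h in-name)) s (Γ β) (cx S β)
  c′ β = Framed-⊆ (λ ok → proj₁ (ok in-name)) (c β)

  leaf : ∀ {fs} → Framed (Ok s (wf h)) s (Γ α) fs → SN (plug fs (sub S M))
  leaf none = SN-instance (h in-name) (instance′ r f c′)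
  leaf (one {N} p ok) = subst (λ X → SN (infill s X (sub S M)))
    (rename-id (λ _ → refl) (λ _ → refl) N)
    (proj₂ (ok in-name) id id (instance′ r (Fit-weaken p M f) c′))
SN-instance {s = s} {b} {Γ} {Δ} {M = M · N} {S} (wf h) (instance′ r f c) = SN-·
  (SN-instance (h in-·ˡ) (instance′ r (proj₁ f) (c↝ in-·ˡ)))
  (SN-instance (h in-·ʳ) (instance′ r (proj₂ f) (c↝ in-·ʳ)))
  hβ hμ hμ′
  where
  c↝ : ∀ {l₁ m₁} {X : Term l₁ m₁} (q : M · N ↝ X) β → Framed (Ok s (h q)) s (Γ β) (cx S β)
  c↝ q β = Framed-⊆ (λ ok → proj₁ (ok q)) (c β)

  IH : ∀ {X} → M · N ▷ X → SN (sub S X)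
  IH q = SN-instance (h (red q)) (instance′ r (Fit-▷ q f) (c↝ (red q)))

  SN-μ⁻¹ : ∀ {l m} {X : Term l (suc m)} → SN (μ X) → SN X
  SN-μ⁻¹ = SN-reflect μ ξ-μ

  hβ : ∀ {P} → sub S M ▷* ƛ P → SN (sub (β-sub (sub S N)) P)
  hβ rs with reflect-ƛ M r rs
  -- Here `M · N` is itself a redex: the instance of its contractum is strongly normalizing by
  -- induction and reduces to the required term.
  ... | Q , ε , ss = SN-reduct (subst SN (sub-β Q) (IH (β-step Q))) (β-sub-mono ss ε)
  -- Otherwise the first step `q` already yields a descendant of `M · N`, whose instance still
  -- reduces to the redex and then to its contractum.
  ... | Q , q ◅ qs , ss = SN-reduct (IH (ξ-·ˡ q))
    (▷*-· (▷*-sub qs ◅◅ gmap ƛ ξ-ƛ ss) ε ◅◅ β-step _ ◅ ε)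

  hμ : ∀ {P} → sub S M ▷* μ P → SN (sub (μ-sub left (sub S N)) P)
  hμ rs with reflect-μ M r rs
  ... | Q , ε , ss = SN-reduct (subst SN (sub-μ Q) (SN-μ⁻¹ (IH (μ-step left)))) (μ-sub-mono left ss ε)
  ... | Q , q ◅ qs , ss = SN-μ⁻¹ (SN-reduct (IH (ξ-·ˡ q))
    (▷*-· (▷*-sub qs ◅◅ gmap μ ξ-μ ss) ε ◅◅ μ-step left ◅ ε))

  hμ′ : ∀ {P} → sub S N ▷* μ P → SN (sub (μ-sub right (sub S M)) P)
  hμ′ rs with reflect-μ N r rs
  ... | Q , ε , ss = SN-reduct (subst SN (sub-μ Q) (SN-μ⁻¹ (IH (μ-step right)))) (μ-sub-mono right ss ε)
  ... | Q , q ◅ qs , ss = SN-μ⁻¹ (SN-reduct (IH (ξ-·ʳ q))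
    (▷*-· ε (▷*-sub qs ◅◅ gmap μ ξ-μ ss) ◅◅ μ-step right ◅ ε))

-- Applications of instances

mutual
  -- The recursion is on the pair `w`, `v`: `Ok-left` returns here with a smaller `w` and the same
  -- `v`, `Ok-right` with a smaller `v` and the same `w`.
  SN-instance-· : ∀ {l₁ m₁ l₂ m₂ Γ Δ Γ′ Δ′} {M : Term l₁ m₁} {N : Term l₂ m₂}
    {S : Sub l₁ m₁ l m} {R : Sub l₂ m₂ l m} (w : Wf M) (v : Wf N) →
    Instance (Ok left w) left true Γ Δ S M → Instance (Ok right v) right false Γ′ Δ′ R N →
    SN (sub S M · sub R N)
  SN-instance-· {Γ = Γ} {Γ′ = Γ′} {M = M} {N} {S} {R} w v i j =
    SN-· (SN-instance w i) (SN-instance v j) hβ hμ hμ′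
    where
    hβ : ∀ {P} → sub S M ▷* ƛ P → SN (sub (β-sub (sub R N)) P)
    hβ rs with reflect-ƛ M (isren i) rs
    -- Neutrality persists along `qs`, and an abstraction is never neutral.
    ... | Q , qs , _ = ⊥-elim (proj₁ (Fit-▷* qs (fit i)) tt)

    hμ : ∀ {P} → sub S M ▷* μ P → SN (sub (μ-sub left (sub R N)) P)
    hμ rs with reflect-μ M (isren i) rs
    -- The new frame is shown to be `Ok` for `w` itself, where the recursion is available, and then
    -- carried along `qs` by `down`; abstracting both together lets the proof for the reduct be
    -- matched as `wf h`.
    ... | Q , qs , ss with Wf-▷* qs w | (λ {X : Term _ _} → Ok-▷* {s = left} {N = X} qs w)
    ... | wf h | down = SN-reduct
      (subst SN (sym (sub-sub Comp-⇑μ-μ-sub Q)) (SN-instance (h in-μ) (instance′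
        (IsRen-⇑μ (isren i)) (Fit-▷* qs (fit i))
        -- Neutrality of `μ Q` marks the bound variable, as a left frame requires.
        (λ { zero → one id (Ok-rename (h in-μ) (proj₁ (down (Ok-left w v j) in-μ)))
           ; (suc α) → Framed-map (λ ok → Ok-rename (h in-μ) (proj₁ (down ok in-μ)))
                                  (framed i α) }))))
      (μ-sub-mono left ss ε)

    hμ′ : ∀ {P} → sub R N ▷* μ P → SN (sub (μ-sub right (sub S M)) P)
    hμ′ rs with reflect-μ N (isren j) rs
    ... | Q , qs , ss with Wf-▷* qs v | (λ {X : Term _ _} → Ok-▷* {s = right} {N = X} qs v)
    ... | wf h | down = SN-reduct
      (subst SN (sym (sub-sub Comp-⇑μ-μ-sub Q)) (SN-instance (h in-μ) (instance′
        (IsRen-⇑μ (isren j)) (Fit-▷* qs (fit j))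
        (λ { zero → one (λ ()) (Ok-rename (h in-μ) (proj₁ (down (Ok-right w v i) in-μ)))
           ; (suc α) → Framed-map (λ ok → Ok-rename (h in-μ) (proj₁ (down ok in-μ)))
                                  (framed j α) }))))
      (μ-sub-mono right ss ε)

  Ok-left : ∀ {l₁ m₁ l₂ m₂ Γ Δ} {M : Term l₁ m₁} {N : Term l₂ m₂} {R : Sub l₂ m₂ l m}
    (w : Wf M) (v : Wf N) → Instance (Ok right v) right false Γ Δ R N → Ok left w (sub R N)
  Ok-left {N = N} (wf h) v j r = Ok-left (h r) v j , λ ρ θ i →
    subst (λ X → SN (_ · X)) (sym (rename-sub (λ _ → refl) (λ _ → refl) (λ _ → refl) N))
      (SN-instance-· (h r) v i (Instance-rename v j))

  Ok-right : ∀ {l₁ m₁ l₂ m₂ Γ Δ} {M : Term l₁ m₁} {N : Term l₂ m₂} {S : Sub l₁ m₁ l m}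
    (w : Wf M) (v : Wf N) → Instance (Ok left w) left true Γ Δ S M → Ok right v (sub S M)
  Ok-right {M = M} w (wf h) i r = Ok-right w (h r) i , λ ρ θ j →
    subst (λ X → SN (X · _)) (sym (rename-sub (λ _ → refl) (λ _ → refl) (λ _ → refl) M))
      (SN-instance-· w (h r) (Instance-rename w i) j)

-- Each term is its own instance under the identity, which has no frames, so no `Ok` condition has
-- to be met at the start.
SN-neutral-· : {M N : Term l m} → Fit true (λ _ → false) (λ _ → true) M →
  SN M → SN N → SN (M · N)
SN-neutral-· {M = M} {N} f snM snN = subst₂ (λ X Y → SN (X · Y)) (sub-ids M) (sub-ids N)
  (SN-instance-· (SN⇒Wf snM) (SN⇒Wf snN)
    (instance′ ids-ren f (λ _ → none))
    (instance′ {Γ = λ _ → false} {Δ = λ _ → true} ids-ren (Fit-false (λ _ → id) N) (λ _ → none)))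
  where
  ids-ren : IsRen (ids {l} {m})
  ids-ren = isRen λ x → x , refl

-- Applying a neutral term gives a neutral term, so the arguments can be added one at a time.
SN-apply : {M : Term l m} {n : ℕ} (Ns : Vec (Term l m) n) →
  Fit true (λ _ → false) (λ _ → true) M → SN M → All SN Ns → SN (apply M Ns)
SN-apply []       f sn []         = sn
SN-apply (N ∷ Ns) f sn (sn′ ∷ sns) =
  SN-apply Ns (f , Fit-false (λ _ → id) N) (SN-neutral-· f sn sn′) sns

theorem3p10 : ∀ {l m : ℕ} (x : Fin l) (n : ℕ) (Ms : Vec (Term l m) n) →
    All SN Ms → SN (apply (var x) Ms)
theorem3p10 x n Ms sns = SN-apply Ms (λ _ → tt) (acc λ ()) sns
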